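{- Let $m$ be a positive integer, let $\Omega = \{x_1, x_2, \ldots, x_m\}$ be a set of $m$ (distinct, commuting) variables, and let $u$ be an additional variable. Let $\Pi(\Omega)$ denote the set of all set partitions of $\Omega$. Then the polynomial identity $$\sum_{P \in \Pi(\Omega)} \prod_{T\in P} u\Big(\sum_{x\in T} x \Big)^{|T|-1} = u \Big(u +\sum_{x\in\Omega} x\Big)^{m-1}$$ holds.
   Context: A set partition $P$ of $\Omega$ is an unordered collection of nonempty, pairwise disjoint subsets of $\Omega$ (called parts) whose union is $\Omega$. For a part $T \in P$, $|T|$ denotes its number of elements. The identity is one of polynomials in the commuting variables $u, x_1, \ldots, x_m$; a zeroth power equals $1$. The factor $u$ on the left-hand side lies inside the product over $T \in P$, so each partition $P$ contributes one factor $u$ per part. -}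

module Defs where

open import Algebra.Bundles using (CommutativeRing; RawSemiring)
import Algebra.Definitions.RawSemiring as RawSemiringDefinitions
open import Data.Fin.Base using (Fin)
open import Data.Fin.Subset using (Subset; inside; outside; Nonempty; Empty; ⊤; ⋃; _∩_)
open import Data.Fin.Subset.Properties using (nonempty?; _∈?_)
open import Data.List.Base as List using (List; []; _∷_; [_]; _++_; map; foldr; filter; allFin; cartesianProductWith)
open import Data.List.Relation.Unary.All using (All; all?)
open import Data.List.Relation.Unary.AllPairs using (AllPairs; allPairs?)
open import Data.Bool.Properties using () renaming (_≟_ to _≟ᵇ_)
open import Data.Nat.Base as ℕ using (ℕ; zero; suc)
open import Data.Nat.Properties using () renaming (_≟_ to _≟ⁿ_)
open import Data.Product.Base using (_×_; _,_; proj₁; proj₂)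
open import Data.Vec.Base as Vec using (Vec; []; _∷_; _[_]≔_)
import Data.Vec.Properties as Vec
open import Relation.Binary.PropositionalEquality using (_≡_)
open import Relation.Nullary.Decidable using (Dec; ¬?; _×-dec_)

------------------------------------------------------------------------
-- Set partitions

-- The order of P plays no role in any of the three conditions.  Since
-- the parts are nonempty, pairwise disjointness also excludes repetitions.
IsSetPartition : ∀ {n} → List (Subset n) → Set
IsSetPartition P =
    All Nonempty P
  × AllPairs (λ S T → Empty (S ∩ T)) P
  × ⋃ P ≡ ⊤

isSetPartition? : ∀ {n} (P : List (Subset n)) → Dec (IsSetPartition P)
isSetPartition? P =
        all? nonempty? P
  ×-dec allPairs? (λ S T → ¬? (nonempty? (S ∩ T))) P
  ×-dec Vec.≡-dec _≟ᵇ_ (⋃ P) ⊤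

subsets : ∀ n → List (Subset n)
subsets zero    = [ [] ]
subsets (suc n) = map (inside ∷_) (subsets n) ++ map (outside ∷_) (subsets n)

sublists : ∀ {a} {A : Set a} → List A → List (List A)
sublists []       = [ [] ]
sublists (x ∷ xs) = map (x ∷_) (sublists xs) ++ sublists xs

-- `subsets n` lists every subset of Fin n exactly once, so its sublists
-- represent every (unordered) set of subsets of Fin n exactly once.
setPartitions : ∀ n → List (List (Subset n))
setPartitions n = filter isSetPartition? (sublists (subsets n))

elements : ∀ {n} → Subset n → List (Fin n)
elements {n} T = filter (_∈? T) (allFin n)

------------------------------------------------------------------------
-- Polynomials over K in n commuting variables

module Polynomials {c ℓ} (K : CommutativeRing c ℓ) (n : ℕ) where

  private module K = CommutativeRing K

  -- e stands for the monomial ∏ᵢ Xᵢ ^ eᵢ.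
  Exponent : Set
  Exponent = Vec ℕ n

  -- A finite formal sum of terms; exponents may repeat and coefficients
  -- may vanish, which is accounted for by the equality _≈ᴾ_.
  Polynomial : Set c
  Polynomial = List (K.Carrier × Exponent)

  coefficient : Polynomial → Exponent → K.Carrier
  coefficient p e =
    foldr K._+_ K.0# (map proj₁ (filter (λ t → Vec.≡-dec _≟ⁿ_ (proj₂ t) e) p))

  _≈ᴾ_ : Polynomial → Polynomial → Set ℓ
  p ≈ᴾ q = ∀ e → coefficient p e K.≈ coefficient q e

  _*ᵗ_ : K.Carrier × Exponent → K.Carrier × Exponent → K.Carrier × Exponent
  (a , e) *ᵗ (b , f) = a K.* b , Vec.zipWith ℕ._+_ e f

  rawSemiring : RawSemiring c ℓ
  rawSemiring = record
    { Carrier = Polynomial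
    ; _≈_     = _≈ᴾ_
    ; _+_     = _++_
    ; _*_     = cartesianProductWith _*ᵗ_
    ; 0#      = []
    ; 1#      = [ K.1# , Vec.replicate n 0 ]
    }

  var : Fin n → Polynomial
  var i = [ K.1# , Vec.replicate n 0 [ i ]≔ 1 ]

  open RawSemiring rawSemiring public using (_≈_; _+_; _*_; 0#; 1#)
  open RawSemiringDefinitions rawSemiring public using (_^_)

  sumOver : ∀ {a} {A : Set a} → List A → (A → Polynomial) → Polynomial
  sumOver xs f = foldr _+_ 0# (map f xs)

  productOver : ∀ {a} {A : Set a} → List A → (A → Polynomial) → Polynomial
  productOver xs f = foldr _*_ 1# (map f xs)

  infix 5 sumOver productOver
  syntax sumOver     xs (λ x → p) = Σ[ x ← xs ] p
  syntax productOver xs (λ x → p) = Π[ x ← xs ] p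

{-# OPTIONS --safe #-}

-- Removing the part that contains x₁ turns the left-hand side into
--   Σ_{S ⊆ Ω∖x₁} u (x₁ + x_S)^|S| · F(Ω∖x₁∖S),
-- where F(Ω) denotes the sum over all set partitions of Ω.  By induction the
-- theorem thus reduces to Hurwitz's form of Abel's binomial identity,
--   Σ_{S ⊔ T = L} A x S · B y T = B (x + y) L,
-- with A x L = x (x + x_L)^(|L|-1) and B y L = (y + x_L)^|L|.  Hurwitz's identity
-- is proved by induction on |L| together with its companion
--   Σ_{S ⊔ T = L} A x S · A y T = A (x + y) L :
-- the companion follows by looking at which side the first element of L lies,
-- and  B y L = A y L + Σ_{i ∈ L} x_i B (y + x_i) (L∖i)  leads back from it to
-- the identity itself.  No step subtracts, so all this is valid in every
-- commutative semiring.
module Submission where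

open import Defs
open import Algebra.Bundles using (CommutativeRing; CommutativeSemiring; RawSemiring)
import Algebra.Definitions.RawSemiring as RawSemiringDefinitions
import Algebra.Properties.CommutativeSemigroup as CommutativeSemigroupProperties
open import Algebra.Structures using (IsCommutativeSemiring)
open import Algebra.Structures.Biased using (isCommutativeSemiringˡ; isCommutativeMonoidˡ)
open import Data.Bool.Base using (true; false; if_then_else_)
open import Data.Bool.Properties using () renaming (_≟_ to _≟ᵇ_)
open import Data.Empty using (⊥-elim)
open import Data.Fin.Base using (Fin; zero; suc)
open import Data.Fin.Subset
  using (Subset; inside; outside; Nonempty; Empty; ∣_∣; ⊤; ⊥; ⋃; _∩_; _∪_; _─_; _⊆_)
open import Data.Fin.Subset.Properties
  using (nonempty?; _⊆?_; _∈?_; out⊆; in⊆in; drop-∷-⊆; drop-∷-Empty; p⊆p∪q; q⊆p∪q; x∈p∩q⁺;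
         x∈p∩q⁻; x∈p∪q⁻; ∉⊥)
open import Data.List.Base using (List; []; _∷_; _++_; map; foldr; filter; allFin; tabulate; length)
open import Data.List.Properties using (++-assoc; map-∘; map-tabulate; length-tabulate)
open import Data.List.Relation.Unary.All using (All; []; _∷_)
open import Data.List.Relation.Unary.AllPairs using (AllPairs; []; _∷_)
open import Data.Nat.Base as ℕ using (ℕ; zero; suc; _∸_; NonZero)
open import Data.Nat.Properties as ℕ using ()
open import Data.Product.Base using (_×_; _,_; proj₁; proj₂)
open import Data.Sum.Base using (inj₁; inj₂)
open import Data.Vec.Base as Vec using ([]; _∷_; here; there)
import Data.Vec.Properties as Vec
open import Function.Base using (_∘_; id; flip)
open import Function.Bundles using (_⇔_; mk⇔; Equivalence)
open import Function.Construct.Composition using (_⇔-∘_)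
open import Level using (Level; _⊔_)
open import Relation.Binary.Core using (Rel)
open import Relation.Binary.PropositionalEquality as ≡ using (_≡_; cong; cong₂)
open import Relation.Binary.Structures using (IsEquivalence)
open import Relation.Nullary.Decidable using (Dec; yes; no; does; does-⇔; dec-false; _×-dec_)
open import Relation.Nullary.Negation using (¬_)
open import Relation.Unary using (Pred; Decidable)

private
  variable
    a p q : Level
    X Y : Set a
    n : ℕ

-- Partitions of a subset

-- Taking a part `C` out of a partition of `U` leaves a partition of `U ─ C`, so the union must be
-- allowed to vary. At `⊤` this unfolds to `IsSetPartition`.
IsPartitionOf : Subset n → List (Subset n) → Set
IsPartitionOf U P =
    All Nonempty P
  × AllPairs (λ S T → Empty (S ∩ T)) P
  × ⋃ P ≡ U

disjoint-⋃⁺ : ∀ (C : Subset n) P → All (λ T → Empty (C ∩ T)) P → Empty (C ∩ ⋃ P)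
disjoint-⋃⁺ C []      []       (i , i∈) = ∉⊥ (proj₂ (x∈p∩q⁻ C ⊥ i∈))
disjoint-⋃⁺ C (T ∷ P) (d ∷ ds) (i , i∈) with x∈p∩q⁻ C (⋃ (T ∷ P)) i∈
... | i∈C , i∈T∪P with x∈p∪q⁻ T (⋃ P) i∈T∪P
...   | inj₁ i∈T = d (i , x∈p∩q⁺ (i∈C , i∈T))
...   | inj₂ i∈P = disjoint-⋃⁺ C P ds (i , x∈p∩q⁺ (i∈C , i∈P))

disjoint-⋃⁻ : ∀ (C : Subset n) P → Empty (C ∩ ⋃ P) → All (λ T → Empty (C ∩ T)) P
disjoint-⋃⁻ C []      d = []
disjoint-⋃⁻ C (T ∷ P) d = d ∘ widen (p⊆p∪q (⋃ P)) ∷ disjoint-⋃⁻ C P (d ∘ widen (q⊆p∪q T (⋃ P)))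
  where
  widen : ∀ {V W} → V ⊆ W → Nonempty (C ∩ V) → Nonempty (C ∩ W)
  widen {V} V⊆W (i , i∈) with x∈p∩q⁻ C V i∈
  ... | i∈C , i∈V = i , x∈p∩q⁺ (i∈C , V⊆W i∈V)

disjoint-∪⇒─ : ∀ (C V : Subset n) → Empty (C ∩ V) → V ≡ (C ∪ V) ─ C
disjoint-∪⇒─ []            []            d = ≡.refl
disjoint-∪⇒─ (inside  ∷ C) (inside  ∷ V) d = ⊥-elim (d (zero , here))
disjoint-∪⇒─ (inside  ∷ C) (outside ∷ V) d = cong (outside ∷_) (disjoint-∪⇒─ C V (drop-∷-Empty d))
disjoint-∪⇒─ (outside ∷ C) (v       ∷ V) d = cong (v ∷_) (disjoint-∪⇒─ C V (drop-∷-Empty d))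

∪-─ : ∀ (C U : Subset n) → C ⊆ U → C ∪ (U ─ C) ≡ U
∪-─ []            []            C⊆U = ≡.refl
∪-─ (inside  ∷ C) (inside  ∷ U) C⊆U = cong (inside ∷_) (∪-─ C U (drop-∷-⊆ C⊆U))
∪-─ (inside  ∷ C) (outside ∷ U) C⊆U with C⊆U here
... | ()
∪-─ (outside ∷ C) (v       ∷ U) C⊆U = cong (v ∷_) (∪-─ C U (drop-∷-⊆ C⊆U))

∩-─-Empty : ∀ (C U : Subset n) → Empty (C ∩ (U ─ C))
∩-─-Empty (inside  ∷ C) (v ∷ U) (suc i , there i∈) = ∩-─-Empty C U (i , i∈)
∩-─-Empty (outside ∷ C) (v ∷ U) (suc i , there i∈) = ∩-─-Empty C U (i , i∈)

-- Removing one part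

Admissible : Subset n → Subset n → Set
Admissible C U = Nonempty C × C ⊆ U

admissible? : (C U : Subset n) → Dec (Admissible C U)
admissible? C U = nonempty? C ×-dec C ⊆? U

admissible-inside-inside : ∀ (S U : Subset n) → Admissible (inside ∷ S) (inside ∷ U) ⇔ S ⊆ U
admissible-inside-inside S U = mk⇔ to from
  where
  to : Admissible (inside ∷ S) (inside ∷ U) → S ⊆ U
  to (_ , S⊆U) = drop-∷-⊆ S⊆U
  from : S ⊆ U → Admissible (inside ∷ S) (inside ∷ U)
  from S⊆U = (zero , here) , in⊆in S⊆U

admissible-outside-outside : ∀ (S U : Subset n) → Admissible (outside ∷ S) (outside ∷ U) ⇔ Admissible S U
admissible-outside-outside S U = mk⇔ to from
  where
  to : Admissible (outside ∷ S) (outside ∷ U) → Admissible S U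
  to ((suc i , there i∈S) , S⊆U) = (i , i∈S) , drop-∷-⊆ S⊆U
  from : Admissible S U → Admissible (outside ∷ S) (outside ∷ U)
  from ((i , i∈S) , S⊆U) = (suc i , there i∈S) , out⊆ S⊆U

-- The union condition makes `U` equal to `C ∪ ⋃ P`. Since `C` is disjoint from each part in `P`, it
-- is disjoint from `⋃ P`, and deleting it returns exactly `⋃ P`.
partition-∷⁻ : ∀ {C U : Subset n} {P} → IsPartitionOf U (C ∷ P) →
               Admissible C U × IsPartitionOf (U ─ C) P
partition-∷⁻ {C = C} {P = P} (c ∷ ne , d ∷ ds , ≡.refl) =
  (c , p⊆p∪q (⋃ P)) , ne , ds , disjoint-∪⇒─ C (⋃ P) (disjoint-⋃⁺ C P d)

-- Every part in `P` lies inside `U ─ C`, which misses `C`; this supplies the new disjointness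
-- conditions.
partition-∷⁺ : ∀ {C U : Subset n} {P} → Admissible C U →
               IsPartitionOf (U ─ C) P → IsPartitionOf U (C ∷ P)
partition-∷⁺ {C = C} {U} {P} (c , C⊆U) (ne , ds , eq) =
    c ∷ ne
  , disjoint-⋃⁻ C P (≡.subst (λ V → Empty (C ∩ V)) (≡.sym eq) (∩-─-Empty C U)) ∷ ds
  , ≡.trans (cong (C ∪_) eq) (∪-─ C U C⊆U)

-- Values of a family on a subset

-- Recursion on the bit vector splits off the first point by computation, whereas `elements` filters
-- a list of indices and has to be related to it by `map-elements`.
values : (Fin n → X) → Subset n → List X
values x []            = []
values x (inside  ∷ S) = x zero ∷ values (x ∘ suc) S
values x (outside ∷ S) = values (x ∘ suc) S

filter-∈?-suc : ∀ s (S : Subset n) is →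
                filter (_∈? (s ∷ S)) (map suc is) ≡ map suc (filter (_∈? S) is)
filter-∈?-suc s S []       = ≡.refl
filter-∈?-suc s S (i ∷ is) with does (i ∈? S)
... | true  = cong (suc i ∷_) (filter-∈?-suc s S is)
... | false = filter-∈?-suc s S is

map-tail-elements : ∀ (x : Fin (suc n) → X) s S →
                    map x (filter (_∈? (s ∷ S)) (tabulate suc)) ≡ map (x ∘ suc) (elements S)
map-tail-elements {n} x s S = begin
  map x (filter (_∈? (s ∷ S)) (tabulate suc))         ≡⟨ cong (map x ∘ filter (_∈? (s ∷ S))) (map-tabulate id suc) ⟨
  map x (filter (_∈? (s ∷ S)) (map suc (allFin n)))   ≡⟨ cong (map x) (filter-∈?-suc s S (allFin n)) ⟩
  map x (map suc (elements S))                        ≡⟨ map-∘ (elements S) ⟨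
  map (x ∘ suc) (elements S)                          ∎
  where open ≡.≡-Reasoning

map-elements : ∀ (x : Fin n → X) S → map x (elements S) ≡ values x S
map-elements x []            = ≡.refl
map-elements x (inside  ∷ S) = cong (x zero ∷_) (≡.trans (map-tail-elements x inside S) (map-elements (x ∘ suc) S))
map-elements x (outside ∷ S) = ≡.trans (map-tail-elements x outside S) (map-elements (x ∘ suc) S)

length-values : ∀ (x : Fin n → X) S → length (values x S) ≡ ∣ S ∣
length-values x []            = ≡.refl
length-values x (inside  ∷ S) = cong suc (length-values (x ∘ suc) S)
length-values x (outside ∷ S) = length-values (x ∘ suc) S

values-⊤ : ∀ n (x : Fin n → X) → values x ⊤ ≡ tabulate x
values-⊤ zero    x = ≡.refl
values-⊤ (suc n) x = cong (x zero ∷_) (values-⊤ n (x ∘ suc))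

-- The relation `_~_` is separate from the equality bundled in `R`. The operations can thus be
-- literally those of the theorem while the identities are proved for a finer equality.
module SemiringIdentities
  {a ℓ₀ ℓ} (R : RawSemiring a ℓ₀) {_~_ : Rel (RawSemiring.Carrier R) ℓ}
  (isCommutativeSemiring : IsCommutativeSemiring _~_ (RawSemiring._+_ R) (RawSemiring._*_ R) (RawSemiring.0# R) (RawSemiring.1# R))
  where

  open RawSemiring R using (Carrier; _+_; _*_; 0#; 1#)
  open RawSemiringDefinitions R using (_^_)

  private
    semiring : CommutativeSemiring a ℓ
    semiring = record { isCommutativeSemiring = isCommutativeSemiring }

  open CommutativeSemiring semiring
    using (_≈_; setoid; refl; sym; trans; reflexive; +-cong; +-congˡ; +-congʳ; +-identityˡ; +-identityʳ; +-assoc; +-comm;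
           *-cong; *-congˡ; *-congʳ; *-assoc; *-comm; *-identityˡ; distribˡ; distribʳ; zeroˡ; zeroʳ;
           +-commutativeSemigroup; *-commutativeSemigroup)
  open CommutativeSemigroupProperties +-commutativeSemigroup using ()
    renaming (interchange to +-interchange; x∙yz≈y∙xz to x+[y+z]≈y+[x+z])
  open CommutativeSemigroupProperties *-commutativeSemigroup using ()
    renaming (x∙yz≈y∙xz to x*[y*z]≈y*[x*z])
  open import Relation.Binary.Reasoning.Setoid setoid

  ^-congˡ : ∀ {x y} k → x ≈ y → x ^ k ≈ y ^ k
  ^-congˡ zero    x≈y = refl
  ^-congˡ (suc k) x≈y = *-cong x≈y (^-congˡ k x≈y)

  sum : List Carrier → Carrier
  sum = foldr _+_ 0#

  product : List Carrier → Carrier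
  product = foldr _*_ 1#

  -- Hurwitz's identity

  -- splitSum L f = Σ f S T over the ordered splittings L = S ⊔ T.
  splitSum : List Carrier → (List Carrier → List Carrier → Carrier) → Carrier
  splitSum []      f = f [] []
  splitSum (i ∷ L) f = splitSum L (λ S T → f (i ∷ S) T) + splitSum L (λ S T → f S (i ∷ T))

  -- pickSum L f = Σ f i (L∖i) over the entries i of L.
  pickSum : List Carrier → (Carrier → List Carrier → Carrier) → Carrier
  pickSum []      f = 0#
  pickSum (i ∷ L) f = f i L + pickSum L (λ j R → f j (i ∷ R))

  splitSum-cong : ∀ L {f g} → (∀ S T → f S T ≈ g S T) → splitSum L f ≈ splitSum L g
  splitSum-cong []      f≈g = f≈g [] []
  splitSum-cong (i ∷ L) f≈g = +-cong (splitSum-cong L (λ S → f≈g (i ∷ S))) (splitSum-cong L (λ S T → f≈g S (i ∷ T)))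

  splitSum-+ : ∀ L f g → splitSum L (λ S T → f S T + g S T) ≈ splitSum L f + splitSum L g
  splitSum-+ []      f g = refl
  splitSum-+ (i ∷ L) f g = trans (+-cong (splitSum-+ L _ _) (splitSum-+ L _ _)) (+-interchange _ _ _ _)

  splitSum-*ˡ : ∀ L c f → splitSum L (λ S T → c * f S T) ≈ c * splitSum L f
  splitSum-*ˡ []      c f = refl
  splitSum-*ˡ (i ∷ L) c f = trans (+-cong (splitSum-*ˡ L c _) (splitSum-*ˡ L c _)) (sym (distribˡ c _ _))

  splitSum-flip : ∀ L f → splitSum L f ≈ splitSum L (flip f)
  splitSum-flip []      f = refl
  splitSum-flip (i ∷ L) f = trans (+-comm _ _) (+-cong (splitSum-flip L _) (splitSum-flip L _))

  -- The pointwise hypothesis may use the length and the total of what remains: `B-expand` needs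
  -- both, and the induction in `hurwitz` needs the length.
  pickSum-cong : ∀ L {f g} →
                 (∀ i R → suc (length R) ≡ length L → i + sum R ≈ sum L → f i R ≈ g i R) →
                 pickSum L f ≈ pickSum L g
  pickSum-cong []      f≈g = refl
  pickSum-cong (i ∷ L) f≈g = +-cong (f≈g i L ≡.refl refl)
    (pickSum-cong L (λ j R len s → f≈g j (i ∷ R) (cong suc len) (trans (x+[y+z]≈y+[x+z] j i _) (+-congˡ s))))

  pickSum-+ : ∀ L f g → pickSum L (λ i R → f i R + g i R) ≈ pickSum L f + pickSum L g
  pickSum-+ []      f g = sym (+-identityˡ 0#)
  pickSum-+ (i ∷ L) f g = trans (+-congˡ (pickSum-+ L _ _)) (+-interchange _ _ _ _)

  pickSum-*ˡ : ∀ L c f → pickSum L (λ i R → c * f i R) ≈ c * pickSum L f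
  pickSum-*ˡ []      c f = sym (zeroʳ c)
  pickSum-*ˡ (i ∷ L) c f = trans (+-congˡ (pickSum-*ˡ L c _)) (sym (distribˡ c _ _))

  pickSum-weights : ∀ L c → pickSum L (λ i _ → i * c) ≈ sum L * c
  pickSum-weights []      c = sym (zeroˡ c)
  pickSum-weights (i ∷ L) c = trans (+-congˡ (pickSum-weights L c)) (sym (distribʳ c i _))

  -- Both sides run over the ways to cut `L` into a distinguished entry and two further lists; only
  -- the order of choosing differs.
  splitSum-pickSum : ∀ L (f : Carrier → List Carrier → List Carrier → Carrier) →
                     splitSum L (λ S T → pickSum T (λ i → f i S)) ≈ pickSum L (λ i R → splitSum R (f i))
  splitSum-pickSum []      f = refl
  splitSum-pickSum (i ∷ L) f = begin
    splitSum L (λ S T → pickSum T (λ j → f j (i ∷ S)))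
      + splitSum L (λ S T → f i S T + pickSum T (λ j R → f j S (i ∷ R)))
      ≈⟨ +-congˡ (splitSum-+ L _ _) ⟩
    splitSum L (λ S T → pickSum T (λ j → f j (i ∷ S)))
      + (splitSum L (f i) + splitSum L (λ S T → pickSum T (λ j R → f j S (i ∷ R))))
      ≈⟨ x+[y+z]≈y+[x+z] _ _ _ ⟩
    splitSum L (f i)
      + (splitSum L (λ S T → pickSum T (λ j → f j (i ∷ S)))
         + splitSum L (λ S T → pickSum T (λ j R → f j S (i ∷ R))))
      ≈⟨ +-congˡ (+-cong (splitSum-pickSum L (λ j S → f j (i ∷ S))) (splitSum-pickSum L (λ j S R → f j S (i ∷ R)))) ⟩
    splitSum L (f i)
      + (pickSum L (λ j R → splitSum R (λ S → f j (i ∷ S)))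
         + pickSum L (λ j R → splitSum R (λ S T → f j S (i ∷ T))))
      ≈⟨ +-congˡ (pickSum-+ L _ _) ⟨
    splitSum L (f i)
      + pickSum L (λ j R → splitSum (i ∷ R) (f j)) ∎

  B : Carrier → List Carrier → Carrier
  B y L = (y + sum L) ^ length L

  -- Splitting off the first entry realises the exponent `|L| - 1` without subtraction. On the empty
  -- list, where the formula reads `x` times its inverse, the value is `1#`.
  A : Carrier → List Carrier → Carrier
  A x []      = 1#
  A x (i ∷ L) = x * B (x + i) L

  B-congˡ : ∀ {x y} L → x ≈ y → B x L ≈ B y L
  B-congˡ L x≈y = ^-congˡ (length L) (+-congʳ x≈y)

  -- Distribute one factor `y + sum L` of the power. Its summand `y` gives `A y L`; a summand `i`
  -- leaves a power whose base is regrouped as `y + i` plus the sum of the other entries.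
  B-expand : ∀ y L → B y L ≈ A y L + pickSum L (λ i R → i * B (y + i) R)
  B-expand y []        = sym (+-identityʳ 1#)
  B-expand y L@(j ∷ L′) = begin
    (y + sum L) * c                                     ≈⟨ distribʳ c y (sum L) ⟩
    y * c + sum L * c                                   ≈⟨ +-cong (*-congˡ (^-congˡ (length L′) (sym (+-assoc y j _)))) (sym (pickSum-weights L c)) ⟩
    y * B (y + j) L′ + pickSum L (λ i _ → i * c)        ≈⟨ +-congˡ (pickSum-cong L same) ⟩
    A y L + pickSum L (λ i R → i * B (y + i) R)         ∎
    where
    c : Carrier
    c = (y + sum L) ^ length L′
    same : ∀ i R → suc (length R) ≡ length L → i + sum R ≈ sum L → i * c ≈ i * B (y + i) R
    same i R len s = *-congˡ (begin
      (y + sum L) ^ length L′         ≈⟨ reflexive (cong ((y + sum L) ^_) (ℕ.suc-injective len)) ⟨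
      (y + sum L) ^ length R          ≈⟨ ^-congˡ (length R) (trans (+-assoc y i _) (+-congˡ s)) ⟨
      B (y + i) R                     ∎)

  mutual
    -- The induction is on the length because the list left after picking `i` is not a subterm of
    -- `L`. At `suc k` the companion is used for the same list, and the companion in turn uses the
    -- identity at length `k`.
    hurwitz : ∀ k L → length L ≡ k → ∀ x y → splitSum L (λ S T → A x S * B y T) ≈ B (x + y) L
    hurwitz zero    []      _   x y = *-identityˡ 1#
    hurwitz (suc k) L       len x y = begin
      splitSum L (λ S T → A x S * B y T)
        ≈⟨ splitSum-cong L (λ S T → trans (*-congˡ (B-expand y T)) (distribˡ _ _ _)) ⟩
      splitSum L (λ S T → A x S * A y T + A x S * pickSum T (λ i R → i * B (y + i) R))
        ≈⟨ splitSum-+ L _ _ ⟩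
      splitSum L (λ S T → A x S * A y T) + splitSum L (λ S T → A x S * pickSum T (λ i R → i * B (y + i) R))
        ≈⟨ +-cong (hurwitz-A k L len x y) picked ⟩
      A (x + y) L + pickSum L (λ i R → i * B (x + y + i) R)
        ≈⟨ B-expand (x + y) L ⟨
      B (x + y) L ∎
      where
      picked : splitSum L (λ S T → A x S * pickSum T (λ i R → i * B (y + i) R)) ≈
               pickSum L (λ i R → i * B (x + y + i) R)
      picked = begin
        splitSum L (λ S T → A x S * pickSum T (λ i R → i * B (y + i) R))
          ≈⟨ splitSum-cong L (λ S T → trans (sym (pickSum-*ˡ T (A x S) _))
               (pickSum-cong T (λ i R _ _ → x*[y*z]≈y*[x*z] (A x S) i _))) ⟩
        splitSum L (λ S T → pickSum T (λ i R → i * (A x S * B (y + i) R)))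
          ≈⟨ splitSum-pickSum L (λ i S R → i * (A x S * B (y + i) R)) ⟩
        pickSum L (λ i R → splitSum R (λ S T → i * (A x S * B (y + i) T)))
          ≈⟨ pickSum-cong L (λ i R len′ _ → trans (splitSum-*ˡ R i _) (*-congˡ (trans
               (hurwitz k R (ℕ.suc-injective (≡.trans len′ len)) x (y + i))
               (B-congˡ R (sym (+-assoc x y i)))))) ⟩
        pickSum L (λ i R → i * B (x + y + i) R) ∎

    -- If the first entry `i` lies in `S`, a factor `x` comes out and the identity applies with the
    -- two sides exchanged; if it lies in `T`, a factor `y` comes out. Both cases leave the same
    -- `B (x + y + i) L`.
    hurwitz-A : ∀ k L → length L ≡ suc k → ∀ x y → splitSum L (λ S T → A x S * A y T) ≈ A (x + y) L
    hurwitz-A k (i ∷ L) len x y = begin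
      splitSum L (λ S T → x * B (x + i) S * A y T) + splitSum L (λ S T → A x S * (y * B (y + i) T))
        ≈⟨ +-cong left right ⟩
      x * B (x + y + i) L + y * B (x + y + i) L
        ≈⟨ distribʳ _ x y ⟨
      (x + y) * B (x + y + i) L ∎
      where
      len′ : length L ≡ k
      len′ = ℕ.suc-injective len
      left : splitSum L (λ S T → x * B (x + i) S * A y T) ≈ x * B (x + y + i) L
      left = begin
        splitSum L (λ S T → x * B (x + i) S * A y T)
          ≈⟨ splitSum-cong L (λ S T → trans (*-assoc _ _ _) (*-congˡ (*-comm _ _))) ⟩
        splitSum L (λ S T → x * (A y T * B (x + i) S))
          ≈⟨ trans (splitSum-*ˡ L x _) (*-congˡ (splitSum-flip L _)) ⟩
        x * splitSum L (λ S T → A y S * B (x + i) T)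
          ≈⟨ *-congˡ (hurwitz k L len′ y (x + i)) ⟩
        x * B (y + (x + i)) L
          ≈⟨ *-congˡ (B-congˡ L (trans (x+[y+z]≈y+[x+z] y x i) (sym (+-assoc x y i)))) ⟩
        x * B (x + y + i) L ∎
      right : splitSum L (λ S T → A x S * (y * B (y + i) T)) ≈ y * B (x + y + i) L
      right = begin
        splitSum L (λ S T → A x S * (y * B (y + i) T))
          ≈⟨ splitSum-cong L (λ S T → x*[y*z]≈y*[x*z] _ _ _) ⟩
        splitSum L (λ S T → y * (A x S * B (y + i) T))
          ≈⟨ splitSum-*ˡ L y _ ⟩
        y * splitSum L (λ S T → A x S * B (y + i) T)
          ≈⟨ *-congˡ (hurwitz k L len′ x (y + i)) ⟩
        y * B (x + (y + i)) L
          ≈⟨ *-congˡ (B-congˡ L (sym (+-assoc x y i))) ⟩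
        y * B (x + y + i) L ∎

  -- Sums over lists with side conditions

  -- Only the Boolean `does` is inspected, so a condition that is refuted by the first bits alone
  -- turns its term into `0#` by computation.
  when : {P : Set p} → Dec P → Carrier → Carrier
  when P? x = if does P? then x else 0#

  when-cong : ∀ {P : Set p} (P? : Dec P) {x y} → x ≈ y → when P? x ≈ when P? y
  when-cong P? x≈y with does P?
  ... | true  = x≈y
  ... | false = refl

  when-⇔ : ∀ {P : Set p} {Q : Set q} → P ⇔ Q → (P? : Dec P) (Q? : Dec Q) → ∀ {x} → when P? x ≈ when Q? x
  when-⇔ P⇔Q P? Q? {x} = reflexive (cong (λ d → if d then x else 0#) (does-⇔ P⇔Q P? Q?))

  when-false : ∀ {P : Set p} (P? : Dec P) → ¬ P → ∀ {x} → when P? x ≈ 0#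
  when-false P? ¬prf {x} = reflexive (cong (λ d → if d then x else 0#) (dec-false P? ¬prf))

  when-0 : ∀ {P : Set p} (P? : Dec P) → when P? 0# ≈ 0#
  when-0 P? with does P?
  ... | true  = refl
  ... | false = refl

  when-*ˡ : ∀ {P : Set p} (P? : Dec P) c {x} → when P? (c * x) ≈ c * when P? x
  when-*ˡ P? c with does P?
  ... | true  = refl
  ... | false = sym (zeroʳ c)

  ∑ : List X → (X → Carrier) → Carrier
  ∑ xs f = sum (map f xs)

  ∑-cong : ∀ (xs : List X) {f g : X → Carrier} → (∀ x → f x ≈ g x) → ∑ xs f ≈ ∑ xs g
  ∑-cong []       f≈g = refl
  ∑-cong (x ∷ xs) f≈g = +-cong (f≈g x) (∑-cong xs f≈g)

  ∑-zero : ∀ (xs : List X) {f : X → Carrier} → (∀ x → f x ≈ 0#) → ∑ xs f ≈ 0#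
  ∑-zero []       f≈0 = refl
  ∑-zero (x ∷ xs) f≈0 = trans (+-cong (f≈0 x) (∑-zero xs f≈0)) (+-identityˡ 0#)

  ∑-*ˡ : ∀ (xs : List X) c (f : X → Carrier) → ∑ xs (λ x → c * f x) ≈ c * ∑ xs f
  ∑-*ˡ []       c f = sym (zeroʳ c)
  ∑-*ˡ (x ∷ xs) c f = trans (+-congˡ (∑-*ˡ xs c f)) (sym (distribˡ c _ _))

  ∑-++ : ∀ (xs ys : List X) f → ∑ (xs ++ ys) f ≈ ∑ xs f + ∑ ys f
  ∑-++ []       ys f = sym (+-identityˡ _)
  ∑-++ (x ∷ xs) ys f = trans (+-congˡ (∑-++ xs ys f)) (sym (+-assoc _ _ _))

  ∑-map-++-map : ∀ (g h : X → Y) xs ys f → ∑ (map g xs ++ map h ys) f ≈ ∑ xs (f ∘ g) + ∑ ys (f ∘ h)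
  ∑-map-++-map g h xs ys f = trans (∑-++ (map g xs) (map h ys) f)
    (+-cong (reflexive (cong sum (≡.sym (map-∘ xs)))) (reflexive (cong sum (≡.sym (map-∘ ys)))))

  ∑-filter : ∀ {P : Pred X p} (P? : Decidable P) xs f → ∑ (filter P? xs) f ≈ ∑ xs (λ x → when (P? x) (f x))
  ∑-filter P? []       f = refl
  ∑-filter P? (x ∷ xs) f with does (P? x)
  ... | true  = +-congˡ (∑-filter P? xs f)
  ... | false = trans (∑-filter P? xs f) (sym (+-identityˡ _))

  -- Sums over partitions

  empty? : (U : Subset n) → Dec (⊥ ≡ U)
  empty? = Vec.≡-dec _≟ᵇ_ ⊥

  -- The sum of ∏ w T over the partitions of U into sets from the list Cs.
  partitionSum : (Subset n → Carrier) → List (Subset n) → Subset n → Carrier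
  partitionSum w []       U = when (empty? U) 1#
  partitionSum w (C ∷ Cs) U = when (admissible? C U) (w C * partitionSum w Cs (U ─ C)) + partitionSum w Cs U

  partitionSum-cong : ∀ {v w : Subset n → Carrier} → (∀ C → v C ≈ w C) →
                      ∀ Cs U → partitionSum v Cs U ≈ partitionSum w Cs U
  partitionSum-cong v≈w []       U = refl
  partitionSum-cong v≈w (C ∷ Cs) U =
    +-cong (when-cong (admissible? C U) (*-cong (v≈w C) (partitionSum-cong v≈w Cs (U ─ C)))) (partitionSum-cong v≈w Cs U)

  -- Sublists are sorted by whether they use `C`; those that do vanish unless `C` is admissible. The
  -- predicate `P` is left abstract so that the recursion can pass to `P ∘ (C ∷_)`, which describes
  -- the partitions of `U ─ C`.
  ∑-partitions : ∀ (w : Subset n → Carrier) Cs U {P : Pred (List (Subset n)) p} (P? : Decidable P) →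
                 (∀ Q → P Q ⇔ IsPartitionOf U Q) →
                 ∑ (sublists Cs) (λ Q → when (P? Q) (product (map w Q))) ≈ partitionSum w Cs U
  ∑-partitions w []       U P? P⇔ =
    trans (+-identityʳ _) (when-⇔ (mk⇔ (proj₂ ∘ proj₂) (λ eq → [] , [] , eq) ⇔-∘ P⇔ []) (P? []) (empty? U))
  ∑-partitions w (C ∷ Cs) U P? P⇔ = begin
    ∑ (map (C ∷_) (sublists Cs) ++ sublists Cs) f
      ≈⟨ ∑-++ (map (C ∷_) (sublists Cs)) (sublists Cs) f ⟩
    ∑ (map (C ∷_) (sublists Cs)) f + ∑ (sublists Cs) f
      ≈⟨ +-cong (reflexive (cong sum (≡.sym (map-∘ (sublists Cs))))) (∑-partitions w Cs U P? P⇔) ⟩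
    ∑ (sublists Cs) (f ∘ (C ∷_)) + partitionSum w Cs U
      ≈⟨ +-congʳ (with-C (admissible? C U)) ⟩
    partitionSum w (C ∷ Cs) U ∎
    where
    f : List (Subset _) → Carrier
    f Q = when (P? Q) (product (map w Q))
    with-C : (d : Dec (Admissible C U)) →
             ∑ (sublists Cs) (f ∘ (C ∷_)) ≈ when d (w C * partitionSum w Cs (U ─ C))
    with-C (yes adm) = begin
      ∑ (sublists Cs) (f ∘ (C ∷_))
        ≈⟨ ∑-cong (sublists Cs) (λ Q → when-*ˡ (P? (C ∷ Q)) (w C)) ⟩
      ∑ (sublists Cs) (λ Q → w C * when (P? (C ∷ Q)) (product (map w Q)))
        ≈⟨ ∑-*ˡ (sublists Cs) (w C) _ ⟩
      w C * ∑ (sublists Cs) (λ Q → when (P? (C ∷ Q)) (product (map w Q)))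
        ≈⟨ *-congˡ (∑-partitions w Cs (U ─ C) (P? ∘ (C ∷_))
             (λ Q → mk⇔ (proj₂ ∘ partition-∷⁻) (partition-∷⁺ adm) ⇔-∘ P⇔ (C ∷ Q))) ⟩
      w C * partitionSum w Cs (U ─ C) ∎
    with-C (no ¬adm) = ∑-zero (sublists Cs) (λ Q → when-false (P? (C ∷ Q))
      (¬adm ∘ proj₁ ∘ partition-∷⁻ ∘ Equivalence.to (P⇔ (C ∷ Q))))

  -- A set with the first point is not contained in a target without it, so each such candidate
  -- contributes a term that computes to `0#`.
  partitionSum-inside-outside : ∀ (w : Subset (suc n) → Carrier) Ss Cs U →
    partitionSum w (map (inside ∷_) Ss ++ Cs) (outside ∷ U) ≈ partitionSum w Cs (outside ∷ U)
  partitionSum-inside-outside w []       Cs U = refl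
  partitionSum-inside-outside w (S ∷ Ss) Cs U = trans
    (+-congˡ (partitionSum-inside-outside w Ss Cs U)) (+-identityˡ _)

  -- The first point stays in the target however many of these sets are removed, so the target never
  -- becomes empty.
  partitionSum-outside-inside : ∀ (w : Subset (suc n) → Carrier) Ss U →
    partitionSum w (map (outside ∷_) Ss) (inside ∷ U) ≈ 0#
  partitionSum-outside-inside w []       U = refl
  partitionSum-outside-inside w (S ∷ Ss) U = trans
    (+-cong (trans (when-cong adm? (trans (*-congˡ (partitionSum-outside-inside w Ss (U ─ S))) (zeroʳ _))) (when-0 adm?))
            (partitionSum-outside-inside w Ss U))
    (+-identityˡ 0#)
    where
    adm? : Dec (Admissible (outside ∷ S) (inside ∷ U))
    adm? = admissible? (outside ∷ S) (inside ∷ U)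

  partitionSum-outside-outside : ∀ (w : Subset (suc n) → Carrier) Ss U →
    partitionSum w (map (outside ∷_) Ss) (outside ∷ U) ≈ partitionSum (w ∘ (outside ∷_)) Ss U
  partitionSum-outside-outside w []       U =
    when-⇔ (mk⇔ Vec.∷-injectiveʳ (cong (outside ∷_))) (empty? (outside ∷ U)) (empty? U)
  partitionSum-outside-outside w (S ∷ Ss) U = +-cong
    (trans (when-cong adm? (*-congˡ (partitionSum-outside-outside w Ss (U ─ S))))
           (when-⇔ (admissible-outside-outside S U) adm? (admissible? S U)))
    (partitionSum-outside-outside w Ss U)
    where
    adm? : Dec (Admissible (outside ∷ S) (outside ∷ U))
    adm? = admissible? (outside ∷ S) (outside ∷ U)

  -- At most one part contains the first point. Once `inside ∷ S` is chosen, the remaining target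
  -- lacks that point, and the later candidates containing it drop out.
  partitionSum-inside-inside : ∀ (w : Subset (suc n) → Carrier) Ss Cs U →
    partitionSum w (map (inside ∷_) Ss ++ Cs) (inside ∷ U) ≈
    ∑ Ss (λ S → when (S ⊆? U) (w (inside ∷ S) * partitionSum w Cs (outside ∷ (U ─ S)))) + partitionSum w Cs (inside ∷ U)
  partitionSum-inside-inside w []       Cs U = sym (+-identityˡ _)
  partitionSum-inside-inside w (S ∷ Ss) Cs U = trans
    (+-cong (trans (when-cong adm? (*-congˡ (partitionSum-inside-outside w Ss Cs (U ─ S))))
                   (when-⇔ (admissible-inside-inside S U) adm? (S ⊆? U)))
            (partitionSum-inside-inside w Ss Cs U))
    (sym (+-assoc _ _ _))
    where
    adm? : Dec (Admissible (inside ∷ S) (inside ∷ U))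
    adm? = admissible? (inside ∷ S) (inside ∷ U)

  -- The positions in `values x U` are the points of `U`, so a subset `S` of `U` is the same as a
  -- splitting into the values on `S` and on `U ─ S`. The first bit of `S` tells on which side the
  -- first entry goes.
  ∑-subsets : ∀ (x : Fin n → Carrier) U f →
              ∑ (subsets n) (λ S → when (S ⊆? U) (f (values x S) (values x (U ─ S)))) ≈ splitSum (values x U) f
  ∑-subsets x []            f = +-identityʳ _
  ∑-subsets {suc n} x (inside ∷ U) f = begin
    ∑ (subsets (suc n)) g
      ≈⟨ ∑-map-++-map (inside ∷_) (outside ∷_) (subsets n) (subsets n) g ⟩
    ∑ (subsets n) (g ∘ (inside ∷_)) + ∑ (subsets n) (g ∘ (outside ∷_))
      ≈⟨ +-cong
           (trans (∑-cong (subsets n) (λ S → when-⇔ (mk⇔ drop-∷-⊆ in⊆in) (inside ∷ S ⊆? inside ∷ U) (S ⊆? U)))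
                  (∑-subsets (x ∘ suc) U (λ S → f (x zero ∷ S))))
           (trans (∑-cong (subsets n) (λ S → when-⇔ (mk⇔ drop-∷-⊆ out⊆) (outside ∷ S ⊆? inside ∷ U) (S ⊆? U)))
                  (∑-subsets (x ∘ suc) U (λ S T → f S (x zero ∷ T)))) ⟩
    splitSum (values x (inside ∷ U)) f ∎
    where
    g : Subset (suc n) → Carrier
    g S = when (S ⊆? (inside ∷ U)) (f (values x S) (values x ((inside ∷ U) ─ S)))
  ∑-subsets {suc n} x (outside ∷ U) f = begin
    ∑ (subsets (suc n)) g
      ≈⟨ ∑-map-++-map (inside ∷_) (outside ∷_) (subsets n) (subsets n) g ⟩
    ∑ (subsets n) (g ∘ (inside ∷_)) + ∑ (subsets n) (g ∘ (outside ∷_))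
      ≈⟨ +-cong
           (∑-zero (subsets n) (λ _ → refl))
           (trans (∑-cong (subsets n) (λ S → when-⇔ (mk⇔ drop-∷-⊆ out⊆) (outside ∷ S ⊆? outside ∷ U) (S ⊆? U)))
                  (∑-subsets (x ∘ suc) U f)) ⟩
    0# + splitSum (values (x ∘ suc) U) f
      ≈⟨ +-identityˡ _ ⟩
    splitSum (values x (outside ∷ U)) f ∎
    where
    g : Subset (suc n) → Carrier
    g S = when (S ⊆? (outside ∷ U)) (f (values x S) (values x ((outside ∷ U) ─ S)))

  -- Evaluation of the sum over all partitions

  weight : Carrier → List Carrier → Carrier
  weight u L = u * sum L ^ (length L ∸ 1)

  -- The target `U` is arbitrary because the induction hypothesis is applied to `U ─ S`, what
  -- remains after the part `inside ∷ S` of the first point is removed.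
  partitionSum-subsets : ∀ n u (x : Fin n → Carrier) U →
                         partitionSum (weight u ∘ values x) (subsets n) U ≈ A u (values x U)
  partitionSum-subsets zero    u x []            = +-identityˡ 1#
  partitionSum-subsets (suc n) u x (outside ∷ U) = begin
    partitionSum (weight u ∘ values x) (subsets (suc n)) (outside ∷ U)
      ≈⟨ partitionSum-inside-outside _ (subsets n) _ U ⟩
    partitionSum (weight u ∘ values x) (map (outside ∷_) (subsets n)) (outside ∷ U)
      ≈⟨ partitionSum-outside-outside _ (subsets n) U ⟩
    partitionSum (weight u ∘ values (x ∘ suc)) (subsets n) U
      ≈⟨ partitionSum-subsets n u (x ∘ suc) U ⟩
    A u (values (x ∘ suc) U) ∎
  partitionSum-subsets (suc n) u x (inside ∷ U) = begin
    partitionSum w (subsets (suc n)) (inside ∷ U)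
      ≈⟨ partitionSum-inside-inside w (subsets n) _ U ⟩
    ∑ (subsets n) (λ S → when (S ⊆? U) (w (inside ∷ S) * partitionSum w (map (outside ∷_) (subsets n)) (outside ∷ (U ─ S))))
      + partitionSum w (map (outside ∷_) (subsets n)) (inside ∷ U)
      ≈⟨ trans (+-congˡ (partitionSum-outside-inside w (subsets n) U)) (+-identityʳ _) ⟩
    ∑ (subsets n) (λ S → when (S ⊆? U) (w (inside ∷ S) * partitionSum w (map (outside ∷_) (subsets n)) (outside ∷ (U ─ S))))
      -- The weight of `inside ∷ S` computes to `u * B (x zero) (values x′ S)`, as the first entry
      -- lowers the exponent to the length of the rest.
      ≈⟨ ∑-cong (subsets n) (λ S → when-cong (S ⊆? U) (trans (*-assoc u _ _) (*-congˡ (trans (*-comm _ _) (*-congʳ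
           (trans (partitionSum-outside-outside w (subsets n) (U ─ S))
                  (partitionSum-subsets n u x′ (U ─ S)))))))) ⟩
    ∑ (subsets n) (λ S → when (S ⊆? U) (u * (A u (values x′ (U ─ S)) * B (x zero) (values x′ S))))
      ≈⟨ ∑-subsets x′ U (λ S T → u * (A u T * B (x zero) S)) ⟩
    splitSum (values x′ U) (λ S T → u * (A u T * B (x zero) S))
      ≈⟨ trans (splitSum-*ˡ (values x′ U) u _) (*-congˡ (splitSum-flip (values x′ U) _)) ⟩
    u * splitSum (values x′ U) (λ S T → A u S * B (x zero) T)
      -- The first point plays the part of `y`; the outcome `u * B (u + x zero) (values x′ U)` is
      -- the second clause of `A`.
      ≈⟨ *-congˡ (hurwitz _ (values x′ U) ≡.refl u (x zero)) ⟩
    A u (values x (inside ∷ U)) ∎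
    where
    x′ : Fin n → Carrier
    x′ = x ∘ suc
    w : Subset (suc n) → Carrier
    w = weight u ∘ values x

  setPartitions-identity : ∀ m .{{_ : NonZero m}} u (x : Fin m → Carrier) →
    ∑ (setPartitions m) (λ P → product (map (λ T → u * ∑ (elements T) x ^ (∣ T ∣ ∸ 1)) P)) ≈
    u * (u + ∑ (allFin m) x) ^ (m ∸ 1)
  setPartitions-identity m@(suc k) u x = begin
    ∑ (setPartitions m) (λ P → product (map w P))
      ≈⟨ ∑-filter isSetPartition? (sublists (subsets m)) _ ⟩
    ∑ (sublists (subsets m)) (λ P → when (isSetPartition? P) (product (map w P)))
      ≈⟨ ∑-partitions w (subsets m) ⊤ isSetPartition? (λ _ → mk⇔ id id) ⟩
    partitionSum w (subsets m) ⊤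
      ≈⟨ partitionSum-cong (λ T → reflexive (cong₂ (λ L t → u * sum L ^ (t ∸ 1)) (map-elements x T) (≡.sym (length-values x T)))) (subsets m) ⊤ ⟩
    partitionSum (weight u ∘ values x) (subsets m) ⊤
      ≈⟨ partitionSum-subsets m u x ⊤ ⟩
    A u (values x ⊤)
      -- As `m` is `suc k`, the list is nonempty: the second clause of `A` applies, with the length
      -- of the tail as exponent.
      ≈⟨ reflexive (cong (A u) (values-⊤ m x)) ⟩
    u * (u + x zero + sum (tabulate (x ∘ suc))) ^ length (tabulate (x ∘ suc))
      ≈⟨ *-congˡ (trans (^-congˡ (length (tabulate (x ∘ suc))) (+-assoc u (x zero) _))
           (reflexive (cong₂ (λ L t → (u + sum L) ^ t) (≡.sym (map-tabulate id x)) (length-tabulate (x ∘ suc))))) ⟩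
    u * (u + ∑ (allFin m) x) ^ k ∎
    where
    w : Subset m → Carrier
    w T = u * ∑ (elements T) x ^ (∣ T ∣ ∸ 1)

-- p ≋ q says that p and q agree under every K-linear functional, not only
-- under the coefficient functionals.  It implies p ≈ᴾ q, and multiplication
-- visibly respects it.
module PolynomialSemiring {c ℓ} (K : CommutativeRing c ℓ) (n : ℕ) where

  private module K = CommutativeRing K
  open Polynomials K n
  open CommutativeSemigroupProperties K.+-commutativeSemigroup using () renaming (interchange to +-interchange)
  open CommutativeSemigroupProperties K.*-commutativeSemigroup using () renaming (x∙yz≈y∙xz to x*[y*z]≈y*[x*z])
  open import Relation.Binary.Reasoning.Setoid K.setoid

  _⊕_ : Exponent → Exponent → Exponent
  _⊕_ = Vec.zipWith ℕ._+_

  -- The value at `p` of the linear functional that sends each monomial `e` to `φ e`.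
  ⟪_,_⟫ : Polynomial → (Exponent → K.Carrier) → K.Carrier
  ⟪ []          , φ ⟫ = K.0#
  ⟪ (a , e) ∷ p , φ ⟫ = a K.* φ e K.+ ⟪ p , φ ⟫

  infix 4 _≋_
  record _≋_ (p q : Polynomial) : Set (c ⊔ ℓ) where
    field at : ∀ φ → ⟪ p , φ ⟫ K.≈ ⟪ q , φ ⟫

  open _≋_

  ⟪⟫-congʳ : ∀ p {φ ψ} → (∀ e → φ e K.≈ ψ e) → ⟪ p , φ ⟫ K.≈ ⟪ p , ψ ⟫
  ⟪⟫-congʳ []            φ≈ψ = K.refl
  ⟪⟫-congʳ ((a , e) ∷ p) φ≈ψ = K.+-cong (K.*-congˡ (φ≈ψ e)) (⟪⟫-congʳ p φ≈ψ)

  ⟪⟫-zero : ∀ p → ⟪ p , (λ _ → K.0#) ⟫ K.≈ K.0#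
  ⟪⟫-zero []            = K.refl
  ⟪⟫-zero ((a , e) ∷ p) = K.trans (K.+-cong (K.zeroʳ a) (⟪⟫-zero p)) (K.+-identityˡ K.0#)

  ⟪⟫-+ : ∀ p φ ψ → ⟪ p , (λ e → φ e K.+ ψ e) ⟫ K.≈ ⟪ p , φ ⟫ K.+ ⟪ p , ψ ⟫
  ⟪⟫-+ []            φ ψ = K.sym (K.+-identityˡ K.0#)
  ⟪⟫-+ ((a , e) ∷ p) φ ψ = K.trans (K.+-cong (K.distribˡ a _ _) (⟪⟫-+ p φ ψ)) (+-interchange _ _ _ _)

  ⟪⟫-*ˡ : ∀ p k φ → ⟪ p , (λ e → k K.* φ e) ⟫ K.≈ k K.* ⟪ p , φ ⟫
  ⟪⟫-*ˡ []            k φ = K.sym (K.zeroʳ k)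
  ⟪⟫-*ˡ ((a , e) ∷ p) k φ =
    K.trans (K.+-cong (x*[y*z]≈y*[x*z] a k _) (⟪⟫-*ˡ p k φ)) (K.sym (K.distribˡ k _ _))

  -- Interchange of two finite sums, by linearity in the functional; commutativity of multiplication
  -- rests on it.
  ⟪⟫-swap : ∀ p q (φ : Exponent → Exponent → K.Carrier) →
            ⟪ p , (λ e → ⟪ q , φ e ⟫) ⟫ K.≈ ⟪ q , (λ f → ⟪ p , (λ e → φ e f) ⟫) ⟫
  ⟪⟫-swap []            q φ = K.sym (⟪⟫-zero q)
  ⟪⟫-swap ((a , e) ∷ p) q φ = begin
    a K.* ⟪ q , φ e ⟫ K.+ ⟪ p , (λ e → ⟪ q , φ e ⟫) ⟫
      ≈⟨ K.+-cong (K.sym (⟪⟫-*ˡ q a (φ e))) (⟪⟫-swap p q φ) ⟩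
    ⟪ q , (λ f → a K.* φ e f) ⟫ K.+ ⟪ q , (λ f → ⟪ p , (λ e → φ e f) ⟫) ⟫
      ≈⟨ ⟪⟫-+ q _ _ ⟨
    ⟪ q , (λ f → a K.* φ e f K.+ ⟪ p , (λ e → φ e f) ⟫) ⟫ ∎

  ⟪+⟫ : ∀ p q φ → ⟪ p + q , φ ⟫ K.≈ ⟪ p , φ ⟫ K.+ ⟪ q , φ ⟫
  ⟪+⟫ []            q φ = K.sym (K.+-identityˡ _)
  ⟪+⟫ ((a , e) ∷ p) q φ = K.trans (K.+-congˡ (⟪+⟫ p q φ)) (K.sym (K.+-assoc _ _ _))

  ⟪*ᵗ⟫ : ∀ a e q φ → ⟪ map ((a , e) *ᵗ_) q , φ ⟫ K.≈ a K.* ⟪ q , (λ f → φ (e ⊕ f)) ⟫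
  ⟪*ᵗ⟫ a e []            φ = K.sym (K.zeroʳ a)
  ⟪*ᵗ⟫ a e ((b , f) ∷ q) φ =
    K.trans (K.+-cong (K.*-assoc a b _) (⟪*ᵗ⟫ a e q φ)) (K.sym (K.distribˡ a _ _))

  -- A functional on a product is a double sum over the terms of both factors. Through this formula
  -- the multiplicative laws reduce to laws for adding exponents and for finite sums.
  ⟪*⟫ : ∀ p q φ → ⟪ p * q , φ ⟫ K.≈ ⟪ p , (λ e → ⟪ q , (λ f → φ (e ⊕ f)) ⟫) ⟫
  ⟪*⟫ []            q φ = K.refl
  ⟪*⟫ ((a , e) ∷ p) q φ = K.trans (⟪+⟫ (map ((a , e) *ᵗ_) q) (p * q) φ) (K.+-cong (⟪*ᵗ⟫ a e q φ) (⟪*⟫ p q φ))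

  ≋-isEquivalence : IsEquivalence _≋_
  ≋-isEquivalence = record
    { refl  = λ where .at φ → K.refl
    ; sym   = λ where p≋q .at φ → K.sym (at p≋q φ)
    ; trans = λ where p≋q q≋r .at φ → K.trans (at p≋q φ) (at q≋r φ)
    }

  +-cong : ∀ {p p′ q q′} → p ≋ p′ → q ≋ q′ → p + q ≋ p′ + q′
  +-cong {p} {p′} {q} {q′} p≋ q≋ .at φ =
    K.trans (⟪+⟫ p q φ) (K.trans (K.+-cong (at p≋ φ) (at q≋ φ)) (K.sym (⟪+⟫ p′ q′ φ)))

  +-comm : ∀ p q → p + q ≋ q + p
  +-comm p q .at φ = K.trans (⟪+⟫ p q φ) (K.trans (K.+-comm _ _) (K.sym (⟪+⟫ q p φ)))

  *-cong : ∀ {p p′ q q′} → p ≋ p′ → q ≋ q′ → p * q ≋ p′ * q′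
  *-cong {p} {p′} {q} {q′} p≋ q≋ .at φ = begin
    ⟪ p * q , φ ⟫                                ≈⟨ ⟪*⟫ p q φ ⟩
    -- The shift of `φ` by `e` is again a functional covered by `_≋_`; a shifted coefficient
    -- functional need not be a coefficient functional.
    ⟪ p , (λ e → ⟪ q , (λ f → φ (e ⊕ f)) ⟫) ⟫    ≈⟨ ⟪⟫-congʳ p (λ e → at q≋ (λ f → φ (e ⊕ f))) ⟩
    ⟪ p , (λ e → ⟪ q′ , (λ f → φ (e ⊕ f)) ⟫) ⟫   ≈⟨ at p≋ _ ⟩
    ⟪ p′ , (λ e → ⟪ q′ , (λ f → φ (e ⊕ f)) ⟫) ⟫  ≈⟨ ⟪*⟫ p′ q′ φ ⟨
    ⟪ p′ * q′ , φ ⟫                              ∎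

  *-assoc : ∀ p q r → (p * q) * r ≋ p * (q * r)
  *-assoc p q r .at φ = begin
    ⟪ (p * q) * r , φ ⟫
      ≈⟨ ⟪*⟫ (p * q) r φ ⟩
    ⟪ p * q , (λ h → ⟪ r , (λ g → φ (h ⊕ g)) ⟫) ⟫
      ≈⟨ ⟪*⟫ p q _ ⟩
    ⟪ p , (λ e → ⟪ q , (λ f → ⟪ r , (λ g → φ ((e ⊕ f) ⊕ g)) ⟫) ⟫) ⟫
      ≈⟨ ⟪⟫-congʳ p (λ e → ⟪⟫-congʳ q (λ f → ⟪⟫-congʳ r (λ g →
           K.reflexive (cong φ (Vec.zipWith-assoc ℕ.+-assoc e f g))))) ⟩
    ⟪ p , (λ e → ⟪ q , (λ f → ⟪ r , (λ g → φ (e ⊕ (f ⊕ g))) ⟫) ⟫) ⟫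
      ≈⟨ ⟪⟫-congʳ p (λ e → ⟪*⟫ q r _) ⟨
    ⟪ p , (λ e → ⟪ q * r , (λ h → φ (e ⊕ h)) ⟫) ⟫
      ≈⟨ ⟪*⟫ p (q * r) φ ⟨
    ⟪ p * (q * r) , φ ⟫ ∎

  *-comm : ∀ p q → p * q ≋ q * p
  *-comm p q .at φ = begin
    ⟪ p * q , φ ⟫                              ≈⟨ ⟪*⟫ p q φ ⟩
    ⟪ p , (λ e → ⟪ q , (λ f → φ (e ⊕ f)) ⟫) ⟫  ≈⟨ ⟪⟫-swap p q _ ⟩
    ⟪ q , (λ f → ⟪ p , (λ e → φ (e ⊕ f)) ⟫) ⟫  ≈⟨ ⟪⟫-congʳ q (λ f → ⟪⟫-congʳ p (λ e → K.reflexive (cong φ (Vec.zipWith-comm ℕ.+-comm e f)))) ⟩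
    ⟪ q , (λ f → ⟪ p , (λ e → φ (f ⊕ e)) ⟫) ⟫  ≈⟨ ⟪*⟫ q p φ ⟨
    ⟪ q * p , φ ⟫                              ∎

  *-identityˡ : ∀ p → 1# * p ≋ p
  *-identityˡ p .at φ = begin
    ⟪ 1# * p , φ ⟫                                           ≈⟨ ⟪*⟫ 1# p φ ⟩
    K.1# K.* ⟪ p , (λ f → φ (Vec.replicate n 0 ⊕ f)) ⟫ K.+ K.0#  ≈⟨ K.trans (K.+-identityʳ _) (K.*-identityˡ _) ⟩
    ⟪ p , (λ f → φ (Vec.replicate n 0 ⊕ f)) ⟫                ≈⟨ ⟪⟫-congʳ p (λ f → K.reflexive (cong φ (Vec.zipWith-identityˡ ℕ.+-identityˡ f))) ⟩
    ⟪ p , φ ⟫                                                ∎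

  *-distribʳ-+ : ∀ r p q → (p + q) * r ≋ p * r + q * r
  *-distribʳ-+ r p q .at φ = begin
    ⟪ (p + q) * r , φ ⟫                 ≈⟨ ⟪*⟫ (p + q) r φ ⟩
    ⟪ p + q , _ ⟫                       ≈⟨ ⟪+⟫ p q _ ⟩
    ⟪ p , _ ⟫ K.+ ⟪ q , _ ⟫             ≈⟨ K.+-cong (⟪*⟫ p r φ) (⟪*⟫ q r φ) ⟨
    ⟪ p * r , φ ⟫ K.+ ⟪ q * r , φ ⟫     ≈⟨ ⟪+⟫ (p * r) (q * r) φ ⟨
    ⟪ p * r + q * r , φ ⟫               ∎

  isCommutativeSemiring : IsCommutativeSemiring _≋_ _+_ _*_ 0# 1#
  isCommutativeSemiring = isCommutativeSemiringˡ record
    { +-isCommutativeMonoid = isCommutativeMonoidˡ record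
      { isSemigroup = record
        { isMagma = record { isEquivalence = ≋-isEquivalence ; ∙-cong = +-cong }
        ; assoc   = λ where p q r .at φ → K.reflexive (cong ⟪_, φ ⟫ (++-assoc p q r))
        }
      ; identityˡ = λ where p .at φ → K.refl
      ; comm      = +-comm
      }
    ; *-isCommutativeMonoid = isCommutativeMonoidˡ record
      { isSemigroup = record
        { isMagma = record { isEquivalence = ≋-isEquivalence ; ∙-cong = *-cong }
        ; assoc   = *-assoc
        }
      ; identityˡ = *-identityˡ
      ; comm      = *-comm
      }
    ; distribʳ = *-distribʳ-+
    ; zeroˡ    = λ where p .at φ → K.refl
    }

  -- From functionals back to coefficients

  indicator : Exponent → Exponent → K.Carrier
  indicator e f = if does (Vec.≡-dec ℕ._≟_ f e) then K.1# else K.0#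

  coefficient-indicator : ∀ p e → coefficient p e K.≈ ⟪ p , indicator e ⟫
  coefficient-indicator []            e = K.refl
  coefficient-indicator ((a , f) ∷ p) e with does (Vec.≡-dec ℕ._≟_ f e)
  ... | true  = K.+-cong (K.sym (K.*-identityʳ a)) (coefficient-indicator p e)
  ... | false = K.trans (coefficient-indicator p e) (K.sym (K.trans (K.+-congʳ (K.zeroʳ a)) (K.+-identityˡ _)))

  ≋⇒≈ : ∀ {p q} → p ≋ q → p ≈ q
  ≋⇒≈ {p} {q} p≋q e = begin
    coefficient p e       ≈⟨ coefficient-indicator p e ⟩
    ⟪ p , indicator e ⟫   ≈⟨ at p≋q (indicator e) ⟩
    ⟪ q , indicator e ⟫   ≈⟨ coefficient-indicator q e ⟨
    coefficient q e       ∎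

theorem1 : ∀ {c ℓ} (K : CommutativeRing c ℓ) (m : ℕ) .{{_ : NonZero m}} →
  let open Polynomials K (suc m)
      u : Polynomial
      u = var zero
      x : Fin m → Polynomial
      x i = var (suc i)
  in (Σ[ P ← setPartitions m ] (Π[ T ← P ] (u * (Σ[ i ← elements T ] x i) ^ (∣ T ∣ ∸ 1))))
       ≈ u * (u + (Σ[ i ← allFin m ] x i)) ^ (m ∸ 1)
-- The sums, products and powers of the semiring identity unfold to those of the statement; the
-- passage from `_≋_` to equality of coefficients comes last.
theorem1 K m = ≋⇒≈ (setPartitions-identity m (var zero) (var ∘ suc))
  where
  open Polynomials K (suc m) using (rawSemiring; var)
  open PolynomialSemiring K (suc m)
  open SemiringIdentities rawSemiring isCommutativeSemiring
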